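{- Let $\Gamma$ be a strongly regular graph with parameters $(99,14,1,2)$ and let $G=\mathrm{Aut}(\Gamma)$ be its full automorphism group. Then $G$ does not contain any element of order $14$.
   Context: A strongly regular graph with parameters $(v,k,\lambda,\mu)$ is a simple $k$-regular graph on $v$ vertices in which any two adjacent vertices have exactly $\lambda$ common neighbors and any two distinct nonadjacent vertices have exactly $\mu$ common neighbors. -}

module Defs where

open import Level using (Level; 0ℓ)
open import Data.Nat.Base using (ℕ; _<_)
open import Data.Fin.Base using (Fin)
open import Data.Fin.Permutation as Perm using (Permutation′; _⟨$⟩ʳ_; _⟨$⟩ˡ_; _∘ₚ_)
open import Data.Fin.Subset using (Subset; _∩_; ∣_∣)
open import Data.Product.Base using (_×_; _,_)
open import Data.Vec.Base using (tabulate)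
open import Function.Base using (_∘_)
open import Function.Bundles using (_⇔_; mk⇔; Equivalence)
open import Algebra.Bundles using (Group)
import Algebra.Definitions.RawMonoid as RawMonoidDefs
open import Relation.Binary.Core using (Rel)
open import Relation.Binary.Definitions using (Decidable; Symmetric)
open import Relation.Nullary using (¬_; does)
open import Relation.Binary.PropositionalEquality
  using (_≡_; _≢_; refl; sym; trans; cong; subst₂)

-- The vertex set of a graph on v vertices is taken to be Fin v.
record SimpleGraph (v : ℕ) : Set₁ where
  field
    Adj       : Rel (Fin v) 0ℓ
    adj?      : Decidable Adj
    symmetric : Symmetric Adj
    loopless  : ∀ x → ¬ Adj x x

  neighbours : Fin v → Subset v
  neighbours x = tabulate (λ y → does (adj? x y))

  commonNeighbours : Fin v → Fin v → Subset v
  commonNeighbours x y = neighbours x ∩ neighbours y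

record IsStronglyRegular {v : ℕ} (Γ : SimpleGraph v) (k λ′ μ : ℕ) : Set where
  open SimpleGraph Γ
  field
    regular     : ∀ x → ∣ neighbours x ∣ ≡ k
    adjacent    : ∀ x y → Adj x y → ∣ commonNeighbours x y ∣ ≡ λ′
    nonadjacent : ∀ x y → x ≢ y → ¬ Adj x y → ∣ commonNeighbours x y ∣ ≡ μ

record Automorphism {v : ℕ} (Γ : SimpleGraph v) : Set where
  open SimpleGraph Γ
  field
    perm      : Permutation′ v
    preserves : ∀ x y → Adj x y ⇔ Adj (perm ⟨$⟩ʳ x) (perm ⟨$⟩ʳ y)

module _ {v : ℕ} (Γ : SimpleGraph v) where
  open SimpleGraph Γ
  open Automorphism

  private
    idᴬ : Automorphism Γ
    idᴬ .perm          = Perm.id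
    idᴬ .preserves _ _ = mk⇔ (λ a → a) (λ a → a)

    -- g ∘ᴬ h applies h first; note that π ∘ₚ ρ applies π first.
    _∘ᴬ_ : Automorphism Γ → Automorphism Γ → Automorphism Γ
    (g ∘ᴬ h) .perm          = perm h ∘ₚ perm g
    (g ∘ᴬ h) .preserves x y = mk⇔
      (Equivalence.to (preserves g _ _) ∘ Equivalence.to (preserves h x y))
      (Equivalence.from (preserves h x y) ∘ Equivalence.from (preserves g _ _))

    _⁻¹ᴬ : Automorphism Γ → Automorphism Γ
    (g ⁻¹ᴬ) .perm          = Perm.flip (perm g)
    (g ⁻¹ᴬ) .preserves x y = mk⇔
      (λ a → Equivalence.from (preserves g _ _)
        (subst₂ Adj (sym (Perm.inverseʳ (perm g))) (sym (Perm.inverseʳ (perm g))) a))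
      (λ a → subst₂ Adj (Perm.inverseʳ (perm g)) (Perm.inverseʳ (perm g))
        (Equivalence.to (preserves g _ _) a))

  -- Automorphisms are identified when they agree on every vertex.
  Aut : Group 0ℓ 0ℓ
  Aut = record
    { Carrier = Automorphism Γ
    ; _≈_     = λ g h → perm g Perm.≈ perm h
    ; _∙_     = _∘ᴬ_
    ; ε       = idᴬ
    ; _⁻¹     = _⁻¹ᴬ
    ; isGroup = record
      { isMonoid = record
        { isSemigroup = record
          { isMagma = record
            { isEquivalence = record
              { refl  = λ _ → refl
              ; sym   = λ p i → sym (p i)
              ; trans = λ p q i → trans (p i) (q i)
              }
            ; ∙-cong = λ {g} {g′} {h} {h′} p q i →
                trans (cong (perm g ⟨$⟩ʳ_) (q i)) (p (perm h′ ⟨$⟩ʳ i))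
            }
          ; assoc = λ _ _ _ _ → refl
          }
        ; identity = (λ _ _ → refl) , (λ _ _ → refl)
        }
      ; inverse = (λ g _ → Perm.inverseˡ (perm g)) , (λ g _ → Perm.inverseʳ (perm g))
      ; ⁻¹-cong = λ {g} {h} p i →
          trans (cong (perm g ⟨$⟩ˡ_)
                  (trans (sym (Perm.inverseʳ (perm h))) (sym (p (perm h ⟨$⟩ˡ i)))))
                (Perm.inverseˡ (perm g))
      }
    }

module _ {c ℓ : Level} (G : Group c ℓ) where
  open Group G using (Carrier; _≈_; ε; rawMonoid)
  open RawMonoidDefs rawMonoid using () renaming (_×_ to _times_)

  -- The library writes the iterated operation additively: n times g is gⁿ.
  HasOrder : Carrier → ℕ → Set ℓ
  HasOrder g n = 0 < n × n times g ≈ ε × (∀ m → 0 < m → m < n → ¬ (m times g ≈ ε))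

{-# OPTIONS --safe #-}
module Submission where

-- Let g have order 14 and σ = g².  Since 7 ∤ 99, σ fixes a vertex x.  The neighbours of x form
-- seven edges; if σ moves one neighbour it moves them all in two orbits of size 7, and an
-- automorphism fixing x and all its neighbours is trivial.  Hence x is the only fixed vertex of σ,
-- so g fixes x and permutes its neighbours p 0, …, p 13 in a single cycle p i = gⁱ a₀, where p i is
-- matched to p (i + 7).  Every other vertex is determined by its two common neighbours with x, so
-- the remaining 84 vertices fall into six regular g-orbits with representatives z s, the vertex
-- other than x joined to both p 0 and p (s + 1).
--
-- The matrix R s t counting the neighbours of z s in the orbit of z t is symmetric, has row sums
-- 12, and satisfies R² + R = 12 I + 24 J.  Counting paths of length two, the neighbours of z s
-- outside {x, p 0, …, p 13} have altogether 12 adjacencies to the points p i with i even; a vertex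
-- whose two points have equal parity contributes 0 or 2, so the number of neighbours of z s whose
-- two points differ in parity is even.  No matrix of natural numbers has all these properties.

open import Defs
open import Data.Product.Base using (∃-syntax)
open import Relation.Nullary using (¬_)

open import Algebra.Bundles using (Group)
import Algebra.Definitions.RawMonoid as RawMonoidDefs
import Algebra.Properties.CommutativeSemigroup as CommutativeSemigroup
open import Data.Bool.Base using (Bool; true; false; if_then_else_; _∨_)
open import Data.Empty using (⊥; ⊥-elim)
open import Data.Fin.Base
  using (Fin; zero; suc; toℕ; punchIn; punchOut; splitAt; join; remQuot; combine; _↑ˡ_; _↑ʳ_)
open import Data.Fin.Patterns using (0F; 1F; 2F; 3F; 4F)
open import Data.Fin.Permutation using (permutation; inverseˡ; _⟨$⟩ʳ_; _⟨$⟩ˡ_)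
open import Data.Fin.Properties as Fin
  using (_≟_; any?; all?; punchInᵢ≢i; punchIn-punchOut; punchOut-injective; splitAt-↑ˡ; splitAt-↑ʳ;
         join-splitAt; remQuot-combine; combine-remQuot; toℕ-fromℕ<)
open import Data.Fin.Subset using (∣_∣; _∩_)
open import Data.List.Base as List using (List; []; _∷_; upTo; concatMap; filter)
open import Data.List.Membership.Propositional using (_∈_; lose)
open import Data.List.Membership.Propositional.Properties
  using (∈-concatMap⁺; ∈-upTo⁺; ∈-map⁺; ∈-filter⁺)
open import Data.List.Relation.Unary.All as All using (All; []; _∷_)
open import Data.List.Relation.Unary.Any using (here)
open import Data.Nat.Base
open import Data.Nat.Divisibility using (_∣_; _∣?_; divides; ∣m+n∣m⇒∣n)
open import Data.Nat.DivMod using (_%_; _/_; _mod_; m%n<n; m≡m%n+[m/n]*n)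
open import Data.Nat.Properties as ℕ hiding (_≟_)
open import Data.Product.Base using (_×_; _,_; proj₁; proj₂; uncurry)
open import Data.Product.Properties using (≡-dec)
open import Data.Sum.Base as Sum using (_⊎_; inj₁; inj₂; [_,_]′)
open import Data.Sum.Properties using (inj₂-injective)
open import Data.Vec.Base as Vec using (Vec; []; _∷_; lookup)
open import Data.Vec.Functional using (removeAt)
open import Data.Vec.Properties using (lookup∘tabulate)
open import Function.Base using (_∘_)
open import Function.Bundles using (Equivalence)
open import Function.Definitions using (Injective)
open import Relation.Nullary using (Dec; yes; no; does)
open import Relation.Nullary.Decidable
open import Relation.Binary.PropositionalEquality
open import Algebra.Properties.Semiring.Sum +-*-semiring
open ≡-Reasoning

-- Finite sums of natural numbers and counting with them.

indicator : Bool → ℕ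
indicator b = if b then 1 else 0

∣tabulate∣ : ∀ {n} (f : Fin n → Bool) → ∣ Vec.tabulate f ∣ ≡ ∑[ i < n ] indicator (f i)
∣tabulate∣ {zero}  f = refl
∣tabulate∣ {suc n} f with f zero
... | true  = cong suc (∣tabulate∣ (f ∘ suc))
... | false = ∣tabulate∣ (f ∘ suc)

∣tabulate∩tabulate∣ : ∀ {n} (f h : Fin n → Bool) →
  ∣ Vec.tabulate f ∩ Vec.tabulate h ∣ ≡ ∑[ i < n ] (indicator (f i) * indicator (h i))
∣tabulate∩tabulate∣ {zero}  f h = refl
∣tabulate∩tabulate∣ {suc n} f h with f zero | h zero
... | true  | true  = cong suc (∣tabulate∩tabulate∣ (f ∘ suc) (h ∘ suc))
... | true  | false = ∣tabulate∩tabulate∣ (f ∘ suc) (h ∘ suc)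
... | false | _     = ∣tabulate∩tabulate∣ (f ∘ suc) (h ∘ suc)

sum-zero : ∀ {n} {f : Fin n → ℕ} → (∀ i → f i ≡ 0) → sum f ≡ 0
sum-zero {n} f≗0 = trans (sum-cong-≗ f≗0) (sum-replicate-zero n)

sum-one : ∀ {n} {f : Fin n → ℕ} (i : Fin n) →
          f i ≡ 1 → (∀ j → i ≢ j → f j ≡ 0) → sum f ≡ 1
sum-one {suc n} {f} i fi≡1 rest = trans (sum-remove {i = i} f)
  (cong₂ _+_ fi≡1 (sum-zero (λ j → rest (punchIn i j) (punchInᵢ≢i i j ∘ sym))))

sum-const : ∀ n c → ∑[ i < n ] c ≡ n * c
sum-const zero    c = refl
sum-const (suc n) c = cong (c +_) (sum-const n c)

sum-positive : ∀ {n} {f : Fin n → ℕ} → 0 < sum f → ∃[ i ] 0 < f i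
sum-positive {suc n} {f} 0<Σ with f zero in eq
... | suc _ = zero , subst (0 <_) (sym eq) z<s
... | zero  with sum-positive {f = f ∘ suc} 0<Σ
...   | i , 0<fi = suc i , 0<fi

-- Induction on m: splitting off the term at `h zero` leaves m injective indices, renumbered by
-- `punchOut`, with positive terms.
injective⇒≤sum : ∀ {m n} (f : Fin n → ℕ) {h : Fin m → Fin n} →
  Injective _≡_ _≡_ h → (∀ i → 0 < f (h i)) → m ≤ sum f
injective⇒≤sum {zero}              f     h-inj pos = z≤n
injective⇒≤sum {suc m} {zero}      f {h} h-inj pos with h zero
... | ()
injective⇒≤sum {suc m} {suc n} f {h} h-inj pos =
  subst (suc m ≤_) (sym (sum-remove {i = h zero} f))
    (+-mono-≤ (pos zero) (injective⇒≤sum (removeAt f (h zero)) {h′} h′-inj pos′))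
  where
  h₀≢ : ∀ i → h zero ≢ h (suc i)
  h₀≢ i eq with () ← h-inj eq
  h′ : Fin m → Fin n
  h′ i = punchOut (h₀≢ i)
  h′-inj : Injective _≡_ _≡_ h′
  h′-inj {i} {j} eq = Fin.suc-injective (h-inj (punchOut-injective (h₀≢ i) (h₀≢ j) eq))
  pos′ : ∀ i → 0 < f (punchIn (h zero) (h′ i))
  pos′ i = subst (λ k → 0 < f k) (sym (punchIn-punchOut (h₀≢ i))) (pos (suc i))

-- An index with positive term outside the image of `h` would extend `h` to m + 1 injective indices,
-- making the sum exceed m. This turns every count below into an exhaustive list.
injective⇒covers : ∀ {m n} (f : Fin n → ℕ) {h : Fin m → Fin n} →
  Injective _≡_ _≡_ h → (∀ i → 0 < f (h i)) → sum f ≡ m →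
  ∀ j → 0 < f j → ∃[ i ] h i ≡ j
injective⇒covers {m} {n} f {h} h-inj pos Σf≡m j 0<fj with any? (λ i → h i ≟ j)
... | yes found = found
... | no absent = ⊥-elim (<-irrefl refl (subst (m <_) Σf≡m (injective⇒≤sum f {h′} h′-inj pos′)))
  where
  h′ : Fin (suc m) → Fin n
  h′ zero    = j
  h′ (suc i) = h i
  h′-inj : Injective _≡_ _≡_ h′
  h′-inj {zero}  {zero}  eq = refl
  h′-inj {zero}  {suc i} eq = ⊥-elim (absent (i , sym eq))
  h′-inj {suc i} {zero}  eq = ⊥-elim (absent (i , eq))
  h′-inj {suc i} {suc k} eq = cong suc (h-inj eq)
  pos′ : ∀ i → 0 < f (h′ i)
  pos′ zero    = 0<fj
  pos′ (suc i) = pos i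

unique-of-sum : ∀ {n} (f : Fin n → ℕ) → sum f ≡ 1 →
  ∃[ i ] (0 < f i × (∀ j → 0 < f j → j ≡ i))
unique-of-sum f Σf≡1 with sum-positive {f = f} (subst (0 <_) (sym Σf≡1) z<s)
... | i , 0<fi = i , 0<fi , λ j 0<fj →
  sym (proj₂ (injective⇒covers f {h} (λ { {zero} {zero} _ → refl }) (λ _ → 0<fi) Σf≡1 j 0<fj))
  where
  h : Fin 1 → Fin _
  h _ = i

-- The bound by 1 prevents a single term from accounting for the whole sum: removing one positive
-- term leaves 1.
pair-of-sum : ∀ {n} (f : Fin n → ℕ) → (∀ i → f i ≤ 1) → sum f ≡ 2 →
  ∃[ i ] ∃[ j ] (i ≢ j × 0 < f i × 0 < f j × (∀ k → 0 < f k → k ≡ i ⊎ k ≡ j))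
pair-of-sum {suc n} f f≤1 Σf≡2 with sum-positive {f = f} (subst (0 <_) (sym Σf≡2) z<s)
... | i , 0<fi with unique-of-sum (removeAt f i) (ℕ.suc-injective
        (trans (cong (_+ sum (removeAt f i)) (sym (≤-antisym (f≤1 i) 0<fi)))
               (trans (sym (sum-remove {i = i} f)) Σf≡2)))
...   | j , 0<fj , only-j = i , punchIn i j , punchInᵢ≢i i j ∘ sym , 0<fi , 0<fj , both
  where
  both : ∀ k → 0 < f k → k ≡ i ⊎ k ≡ punchIn i j
  both k 0<fk with i ≟ k
  ... | yes i≡k = inj₁ (sym i≡k)
  ... | no  i≢k = inj₂ (trans (sym (punchIn-punchOut i≢k)) (cong (punchIn i)
          (only-j (punchOut i≢k) (subst (λ l → 0 < f l) (sym (punchIn-punchOut i≢k)) 0<fk))))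

sum-++ : ∀ m {n} (f : Fin (m + n) → ℕ) →
  sum f ≡ ∑[ i < m ] f (i ↑ˡ n) + ∑[ j < n ] f (m ↑ʳ j)
sum-++ zero    f = refl
sum-++ (suc m) f = trans (cong (f zero +_) (sum-++ m (f ∘ suc))) (sym (+-assoc (f zero) _ _))

sum-combine : ∀ m {n} (f : Fin (m * n) → ℕ) →
  sum f ≡ ∑[ i < m ] ∑[ j < n ] f (combine i j)
sum-combine zero    f = refl
sum-combine (suc m) {n} f = trans (sum-++ n f)
  (cong (∑[ j < n ] f (j ↑ˡ (m * n)) +_) (sum-combine m (λ k → f (n ↑ʳ k))))

-- Adding `F 0` to the shifted sum gives all values from 0 to n, which is also the unshifted sum
-- plus `F n`.
∑-suc : ∀ n (F : ℕ → ℕ) → F n ≡ F 0 →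
  ∑[ i < n ] F (suc (toℕ i)) ≡ ∑[ i < n ] F (toℕ i)
∑-suc n F Fn≡F0 = +-cancelˡ-≡ (F 0) _ _
  (trans (telescope n F) (cong (_+ ∑[ i < n ] F (toℕ i)) Fn≡F0))
  where
  telescope : ∀ n (F : ℕ → ℕ) →
    F 0 + ∑[ i < n ] F (suc (toℕ i)) ≡ F n + ∑[ i < n ] F (toℕ i)
  telescope zero    F = refl
  telescope (suc n) F = trans (cong (F 0 +_) (telescope n (F ∘ suc)))
    (CommutativeSemigroup.x∙yz≈y∙xz +-commutativeSemigroup (F 0) (F (suc n)) (∑[ i < n ] F (suc (toℕ i))))

∑-rotate : ∀ n (F : ℕ → ℕ) → (∀ k → F (n + k) ≡ F k) →
  ∀ k → ∑[ i < n ] F (toℕ i + k) ≡ ∑[ i < n ] F (toℕ i)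
∑-rotate n F periodic zero    = sum-cong-≗ {n} (λ i → cong F (+-identityʳ (toℕ i)))
∑-rotate n F periodic (suc k) = trans
  (sum-cong-≗ {n} (λ i → cong F (+-suc (toℕ i) k)))
  (trans (∑-suc n (λ i → F (i + k)) (periodic k)) (∑-rotate n F periodic k))

argmin : ∀ {n} (h : Fin (suc n) → ℕ) → ∃[ i ] (∀ j → h i ≤ h j)
argmin {zero}  h = zero , λ { zero → ≤-refl }
argmin {suc n} h with argmin (h ∘ suc)
... | i , least with ≤-total (h zero) (h (suc i))
...   | inj₁ h₀≤ = zero  , λ { zero → ≤-refl ; (suc j) → ≤-trans h₀≤ (least j) }
...   | inj₂ ≤h₀ = suc i , λ { zero → ≤h₀   ; (suc j) → least j }

splitAt-injective : ∀ m {n} {i j : Fin (m + n)} → splitAt m i ≡ splitAt m j → i ≡ j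
splitAt-injective m {n} {i} {j} eq =
  trans (sym (join-splitAt m n i)) (trans (cong (join m n) eq) (join-splitAt m n j))

remQuot-injective : ∀ {m} n {i j : Fin (m * n)} → remQuot {m} n i ≡ remQuot n j → i ≡ j
remQuot-injective {m} n {i} {j} eq =
  trans (sym (combine-remQuot {m} n i)) (trans (cong (uncurry combine) eq) (combine-remQuot {m} n j))

-- An injection between sets of equal finite size is onto, so `P` gives a permutation along which
-- the sum is reindexed.
sum-partition : ∀ {v} l m n (P : Fin l ⊎ Fin m × Fin n → Fin v) →
  Injective _≡_ _≡_ P → v ≡ l + m * n → (f : Fin v → ℕ) →
  sum f ≡ ∑[ i < l ] f (P (inj₁ i)) + ∑[ i < m ] ∑[ j < n ] f (P (inj₂ (i , j)))
sum-partition {v} l m n P P-inj v≡ f = begin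
  sum f                        ≡⟨ sum-permute f (permutation e (proj₁ ∘ onto) (proj₂ ∘ onto) (λ k → e-inj (proj₂ (onto (e k))))) ⟩
  sum (f ∘ e)                  ≡⟨ sum-++ l (f ∘ e) ⟩
  ∑[ i < l ] f (e (i ↑ˡ m * n)) + ∑[ k < m * n ] f (e (l ↑ʳ k))
    ≡⟨ cong₂ _+_ (sum-cong-≗ {l} (λ i → cong (f ∘ P ∘ Sum.map₂ (remQuot n)) (splitAt-↑ˡ l i (m * n))))
         (trans (sum-combine m (λ k → f (e (l ↑ʳ k))))
           (sum-cong-≗ {m} λ i → sum-cong-≗ {n} λ j → cong (f ∘ P)
             (trans (cong (Sum.map₂ (remQuot n)) (splitAt-↑ʳ l (m * n) (combine i j)))
                    (cong inj₂ (remQuot-combine i j))))) ⟩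
  ∑[ i < l ] f (P (inj₁ i)) + ∑[ i < m ] ∑[ j < n ] f (P (inj₂ (i , j))) ∎
  where
  e : Fin (l + m * n) → Fin v
  e k = P (Sum.map₂ (remQuot n) (splitAt l k))
  map₂-inj : ∀ {s t : Fin l ⊎ Fin (m * n)} → Sum.map₂ (remQuot n) s ≡ Sum.map₂ (remQuot n) t → s ≡ t
  map₂-inj {inj₁ i} {inj₁ j} refl = refl
  map₂-inj {inj₂ i} {inj₂ j} eq   = cong inj₂ (remQuot-injective n (inj₂-injective eq))
  e-inj : Injective _≡_ _≡_ e
  e-inj eq = splitAt-injective l (map₂-inj (P-inj eq))
  onto : ∀ w → ∃[ k ] e k ≡ w
  onto w = injective⇒covers (λ _ → 1) e-inj (λ _ → z<s)
             (trans (sum-const v 1) (trans (*-identityʳ v) v≡)) w z<s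

-- Exhaustive search for the orbit matrix.

compositions : ∀ k → ℕ → List (Vec ℕ k)
compositions zero    zero    = [] ∷ []
compositions zero    (suc _) = []
compositions (suc k) n       =
  concatMap (λ a → List.map (a ∷_) (compositions k (n ∸ a))) (upTo (suc n))

compositions-complete : ∀ {k} (v : Vec ℕ k) → v ∈ compositions k (Vec.sum v)
compositions-complete []      = here refl
compositions-complete (a ∷ v) = ∈-concatMap⁺ _
  (lose (∈-upTo⁺ (s≤s (m≤m+n a _)))
        (∈-map⁺ (a ∷_) (subst (λ n → v ∈ compositions _ n) (sym (m+n∸m≡n a _))
                              (compositions-complete v))))

Row : Set
Row = Vec ℕ 6

_·_ : Row → Row → ℕ
u · v = Vec.sum (Vec.zipWith _*_ u v)

-- Orbit s consists of the vertices joined to p j and p (j + s + 1), so the two points differ in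
-- parity exactly when s is even.
odd : Fin 6 → ℕ
odd s = 1 ∸ toℕ s % 2

-- The row and entry conditions of R² + R = 12 I + 24 J, where R is symmetric.
Admissible : Fin 6 → Row → Set
Admissible s r = (r · r + lookup r s ≡ 36) × 2 ∣ Vec.tabulate odd · r

Compatible : Fin 6 × Row → Fin 6 × Row → Set
Compatible (s , r) (t , q) = (lookup r t ≡ lookup q s) × (r · q + lookup r t ≡ 24)

admissible? : ∀ s r → Dec (Admissible s r)
admissible? s r = (_ ℕ.≟ _) ×-dec (2 ∣? _)

compatible? : ∀ p q → Dec (Compatible p q)
compatible? (s , r) (t , q) = (_ ℕ.≟ _) ×-dec (_ ℕ.≟ _)

rows : Fin 6 → List Row
rows s = filter (admissible? s) (compositions 6 12)

-- A backtracking tree written as a proposition: no choice of one row per remaining list is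
-- compatible with `chosen` and with itself. Compatibility is a premise, so deciding it prunes a
-- branch before descending.
Inextensible : List (Fin 6 × List Row) → List (Fin 6 × Row) → Set
Inextensible []             _      = ⊥
Inextensible ((s , L) ∷ ss) chosen =
  All (λ r → All (Compatible (s , r)) chosen → Inextensible ss ((s , r) ∷ chosen)) L

inextensible? : ∀ ss chosen → Dec (Inextensible ss chosen)
inextensible? []             _      = no λ ()
inextensible? ((s , L) ∷ ss) chosen = All.all?
  (λ r → All.all? (compatible? (s , r)) chosen →-dec inextensible? ss ((s , r) ∷ chosen)) L

-- The rows with indices 0F to 4F already contradict one another.
search : List (Fin 6 × List Row)
search = List.map (λ s → s , rows s) (0F ∷ 1F ∷ 2F ∷ 3F ∷ 4F ∷ [])

search-fails : Inextensible search []
search-fails = from-yes (inextensible? search [])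

module _ (R : Fin 6 → Fin 6 → ℕ)
  (R-sym : ∀ s t → R s t ≡ R t s)
  (row-sum : ∀ s → ∑[ t < 6 ] R s t ≡ 12)
  (diagonal : ∀ s → ∑[ u < 6 ] (R s u * R s u) + R s s ≡ 36)
  (off-diagonal : ∀ s t → s ≢ t → ∑[ u < 6 ] (R s u * R t u) + R s t ≡ 24)
  (odd-part-even : ∀ s → 2 ∣ ∑[ t < 6 ] (odd t * R s t))
  where

  private
    row : Fin 6 → Row
    row s = Vec.tabulate (R s)

    lookup-row : ∀ s t → lookup (row s) t ≡ R s t
    lookup-row s = lookup∘tabulate (R s)

    row-admissible : ∀ s → row s ∈ rows s
    row-admissible s = ∈-filter⁺ (admissible? s)
      (subst (λ n → row s ∈ compositions 6 n) (row-sum s) (compositions-complete (row s)))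
      (trans (cong (row s · row s +_) (lookup-row s s)) (diagonal s) , odd-part-even s)

    compatible : ∀ s t → s ≢ t → Compatible (s , row s) (t , row t)
    compatible s t s≢t =
      trans (lookup-row s t) (trans (R-sym s t) (sym (lookup-row t s))) ,
      trans (cong (row s · row t +_) (lookup-row s t)) (off-diagonal s t s≢t)

  -- The rows of `R` themselves form a path through the search tree, which ends in a contradiction
  -- after five rows.
  no-orbit-matrix : ⊥
  no-orbit-matrix = step₅
    where
    step₁ = All.lookup search-fails (row-admissible 0F) []
    step₂ = All.lookup step₁ (row-admissible 1F) (compatible 1F 0F (λ ()) ∷ [])
    step₃ = All.lookup step₂ (row-admissible 2F)
      (compatible 2F 1F (λ ()) ∷ compatible 2F 0F (λ ()) ∷ [])
    step₄ = All.lookup step₃ (row-admissible 3F)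
      (compatible 3F 2F (λ ()) ∷ compatible 3F 1F (λ ()) ∷ compatible 3F 0F (λ ()) ∷ [])
    step₅ = All.lookup step₄ (row-admissible 4F)
      (compatible 4F 3F (λ ()) ∷ compatible 4F 2F (λ ()) ∷ compatible 4F 1F (λ ())
        ∷ compatible 4F 0F (λ ()) ∷ [])

-- Arithmetic modulo 14 and adjacency patterns towards the neighbours of x.

toℕ-mod14 : ∀ n → toℕ (n mod 14) ≡ n % 14
toℕ-mod14 n = toℕ-fromℕ< (m%n<n n 14)

-- Up to sign, the differences modulo 14 other than 0 and 7 are 1, ..., 6, one for each orbit.
offset : Fin 6 → Fin 14
offset s = suc (s ↑ˡ 7)

opaque
  -- Subtraction modulo 14, with 13 in the role of -1.
  _⊖_ : Fin 14 → Fin 14 → Fin 14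
  i ⊖ j = (toℕ i + 13 * toℕ j) mod 14

  codeᵖ : Fin 14 → Fin 14 → ℕ
  codeᵖ j i = indicator (does ((toℕ j + 7) % 14 ℕ.≟ toℕ i))

  codeᶻ : Fin 6 → Fin 14 → ℕ
  codeᶻ s k = indicator (does (k ≟ zero) ∨ does (k ≟ offset s))

-- The 1 + 14 + 6 · 14 vertices: inj₁ zero is x, inj₁ (suc i) is p i, and inj₂ (s , j) is gʲ (z s);
-- code c i tells whether vertex c is adjacent to p i.
Index : Set
Index = Fin 15 ⊎ Fin 6 × Fin 14

code : Index → Fin 14 → ℕ
code (inj₁ zero)    i = 1
code (inj₁ (suc j)) i = codeᵖ j i
code (inj₂ (s , j)) i = codeᶻ s (i ⊖ j)

even : Fin 14 → ℕ
even i = 1 ∸ toℕ i % 2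

evenCount : Index → ℕ
evenCount c = ∑[ i < 14 ] (even i * code c i)

opaque
  -- Halving rounds down: the value is 1 if both points of the vertex are even, and 0 otherwise.
  pairs : Fin 6 → Fin 14 → ℕ
  pairs t j = evenCount (inj₂ (t , j)) / 2

opaque
  unfolding _⊖_ pairs

  ⊖-+ : ∀ i j → (toℕ j + toℕ (i ⊖ j)) % 14 ≡ toℕ i % 14
  ⊖-+ = toWitness {a? = all? λ i → all? λ j → _ ℕ.≟ _} _

  codeᵖ≡ : ∀ j i → codeᵖ j i ≡ indicator (does ((toℕ j + 7) % 14 ℕ.≟ toℕ i))
  codeᵖ≡ j i = refl

  codeᶻ≡ : ∀ s k → codeᶻ s k ≡ indicator (does (k ≟ zero) ∨ does (k ≟ offset s))
  codeᶻ≡ s k = refl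

  codeᵖ-offset : ∀ s → codeᵖ zero (offset s) ≡ 0
  codeᵖ-offset = toWitness {a? = all? λ s → _ ℕ.≟ _} _

  -- The patterns have 14, 1 or 2 members. A pair {j, j + s + 1} determines s and j, because its
  -- opposite difference lies between 8 and 13. This is what makes the labelling of the vertices
  -- injective.
  code-injective : ∀ c c′ → (∀ i → code c i ≡ code c′ i) → c ≡ c′
  code-injective (inj₁ i) (inj₁ j) eq = cong inj₁ (table i j eq)
    where
    table : ∀ i j → (∀ k → code (inj₁ i) k ≡ code (inj₁ j) k) → i ≡ j
    table = toWitness {a? = all? λ i → all? λ j → all? (λ k → _ ℕ.≟ _) →-dec (_ ≟ _)} _
  code-injective (inj₁ i) (inj₂ (s , j)) eq = ⊥-elim (table i s j eq)
    where
    table : ∀ i s j → ¬ (∀ k → code (inj₁ i) k ≡ code (inj₂ (s , j)) k)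
    table = toWitness {a? = all? λ i → all? λ s → all? λ j → ¬? (all? λ k → _ ℕ.≟ _)} _
  code-injective (inj₂ (s , j)) (inj₁ i) eq = sym (code-injective (inj₁ i) (inj₂ (s , j)) (sym ∘ eq))
  code-injective (inj₂ (s , i)) (inj₂ (t , j)) eq = cong inj₂ (table s i t j eq)
    where
    table : ∀ s i t j → (∀ k → code (inj₂ (s , i)) k ≡ code (inj₂ (t , j)) k) → (s , i) ≡ (t , j)
    table = toWitness {a? = all? λ s → all? λ i → all? λ t → all? λ j →
      all? (λ k → _ ℕ.≟ _) →-dec ≡-dec _≟_ _≟_ _ _} _

  -- The two members of orbit t joined to p i are those with j = i and j = i - t - 1 modulo 14.
  code-column : ∀ t i → ∑[ j < 14 ] code (inj₂ (t , j)) i ≡ 2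
  code-column = toWitness {a? = all? λ t → all? λ i → _ ℕ.≟ _} _

  codeᶻ-sum : ∀ s c → ∑[ i < 14 ] (codeᶻ s i * c) ≡ 2 * c
  codeᶻ-sum s c = trans (sym (*-distribʳ-sum {14} c (codeᶻ s))) (cong (_* c) (table s))
    where
    table : ∀ s → sum (codeᶻ s) ≡ 2
    table = toWitness {a? = all? λ s → _ ℕ.≟ _} _

  evenCount-z : ∀ t j → evenCount (inj₂ (t , j)) ≡ odd t + pairs t j * 2
  evenCount-z = toWitness {a? = all? λ t → all? λ j → _ ℕ.≟ _} _

  -- The first sum looks at the partners p 7 and p (s + 8) of the two points, the second at p 0 and
  -- p (s + 1). Adding 7 changes parity, so each point and its partner together contribute 1.
  evenCount-neighbours : ∀ s →
    ∑[ k < 14 ] (codeᶻ s k * evenCount (inj₁ (suc k))) + ∑[ i < 14 ] (even i * codeᶻ s i) ≡ 2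
  evenCount-neighbours = toWitness {a? = all? λ s → _ ℕ.≟ _} _

-- Local structure of the graph: triangles and common neighbours.

-- v stays a variable so that sums over the 99 vertices do not unfold.
module Conway {v : ℕ} (Γ : SimpleGraph v) (srg : IsStronglyRegular Γ 14 1 2) where
  open SimpleGraph Γ renaming (Adj to infix 4 _~_; symmetric to ~-sym)
  open IsStronglyRegular srg

  V : Set
  V = Fin v

  a : V → V → ℕ
  a u v = indicator (does (adj? u v))

  ~⇒a≡1 : ∀ {u v} → u ~ v → a u v ≡ 1
  ~⇒a≡1 {u} {v} u~v = cong indicator (dec-true (adj? u v) u~v)

  ≁⇒a≡0 : ∀ {u v} → ¬ u ~ v → a u v ≡ 0
  ≁⇒a≡0 {u} {v} u≁v = cong indicator (dec-false (adj? u v) u≁v)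

  0<a⇒~ : ∀ u v → 0 < a u v → u ~ v
  0<a⇒~ u v pos with adj? u v
  ... | yes u~v = u~v
  ... | no  _   with () ← pos

  0<aa⇒~ : ∀ u v w → 0 < a u w * a v w → u ~ w × v ~ w
  0<aa⇒~ u v w pos with adj? u w | adj? v w
  ... | yes u~w | yes v~w = u~w , v~w
  ... | yes _   | no  _   with () ← pos
  0<aa⇒~ u v w () | no _ | _

  ~⇒0<aa : ∀ {u v w} → u ~ w → v ~ w → 0 < a u w * a v w
  ~⇒0<aa u~w v~w rewrite ~⇒a≡1 u~w | ~⇒a≡1 v~w = z<s

  a-sym : ∀ u v → a u v ≡ a v u
  a-sym u v with adj? u v
  ... | yes u~v = sym (~⇒a≡1 (~-sym u~v))
  ... | no  u≁v = sym (≁⇒a≡0 (u≁v ∘ ~-sym))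

  a≤1 : ∀ u v → a u v ≤ 1
  a≤1 u v with adj? u v
  ... | yes _ = ≤-refl
  ... | no  _ = z≤n

  ~⇒≢ : ∀ {u v} → u ~ v → u ≢ v
  ~⇒≢ u~v refl = loopless _ u~v

  degree : ∀ u → ∑[ w < v ] a u w ≡ 14
  degree u = trans (sym (∣tabulate∣ (λ w → does (adj? u w)))) (regular u)

  codegree : ∀ x y → ∑[ w < v ] (a x w * a y w) ≡ ∣ commonNeighbours x y ∣
  codegree x y = sym (∣tabulate∩tabulate∣ (λ w → does (adj? x w)) (λ w → does (adj? y w)))

  δ : V → V → ℕ
  δ u v = indicator (does (u ≟ v))

  -- The matrix identity A² + A = 12 I + 2 J: the entries are 14 + 0 on the diagonal, 1 + 1 on edges
  -- and 2 + 0 elsewhere.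
  adjacency-square : ∀ x y → ∑[ w < v ] (a x w * a y w) + a x y ≡ 2 + 12 * δ x y
  adjacency-square x y with x ≟ y | adj? x y
  ... | yes refl | yes x~x = ⊥-elim (loopless x x~x)
  ... | yes refl | no  _   = cong (_+ 0) (trans (sum-cong-≗ {v} (λ w → idem (adj? x w))) (degree x))
    where
    idem : ∀ {w} (d : Dec (x ~ w)) → indicator (does d) * indicator (does d) ≡ indicator (does d)
    idem (yes _) = refl
    idem (no  _) = refl
  ... | no _     | yes x~y = cong (_+ 1) (trans (codegree x y) (adjacent x y x~y))
  ... | no x≢y   | no x≁y  = cong (_+ 0) (trans (codegree x y) (nonadjacent x y x≢y x≁y))

  mate : ∀ {u v} → u ~ v → ∃[ m ] (u ~ m × v ~ m)
  mate {u} {v} u~v with unique-of-sum _ (trans (codegree u v) (adjacent u v u~v))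
  ... | m , pos , _ = m , 0<aa⇒~ u v m pos

  mate-unique : ∀ {u v m m′} → u ~ v → u ~ m → v ~ m → u ~ m′ → v ~ m′ → m ≡ m′
  mate-unique {u} {v} {m} {m′} u~v u~m v~m u~m′ v~m′
    with unique-of-sum _ (trans (codegree u v) (adjacent u v u~v))
  ... | _ , _ , only = trans (only m (~⇒0<aa u~m v~m)) (sym (only m′ (~⇒0<aa u~m′ v~m′)))

  record TwoCommon (u v : V) : Set where
    field
      {p q} : V
      p≢q   : p ≢ q
      u~p   : u ~ p
      v~p   : v ~ p
      u~q   : u ~ q
      v~q   : v ~ q
      only  : ∀ {w} → u ~ w → v ~ w → w ≡ p ⊎ w ≡ q

  two-common : ∀ {u v} → u ≢ v → ¬ u ~ v → TwoCommon u v
  two-common {u} {v} u≢v u≁v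
    with pair-of-sum _ (λ w → *-mono-≤ (a≤1 u w) (a≤1 v w))
           (trans (codegree u v) (nonadjacent u v u≢v u≁v))
  ... | p , q , p≢q , posp , posq , only = record
    { p≢q = p≢q
    ; u~p = proj₁ (0<aa⇒~ u v p posp) ; v~p = proj₂ (0<aa⇒~ u v p posp)
    ; u~q = proj₁ (0<aa⇒~ u v q posq) ; v~q = proj₂ (0<aa⇒~ u v q posq)
    ; only = λ {w} u~w v~w → only w (~⇒0<aa u~w v~w) }

  third-common : ∀ {u v x y z} → u ≢ v → ¬ u ~ v → x ≢ y →
    u ~ x → v ~ x → u ~ y → v ~ y → u ~ z → v ~ z → z ≡ x ⊎ z ≡ y
  third-common u≢v u≁v x≢y u~x v~x u~y v~y u~z v~z =
    pigeon x≢y (only u~x v~x) (only u~y v~y) (only u~z v~z)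
    where
    open TwoCommon (two-common u≢v u≁v) using (only)
    pigeon : ∀ {p q x y z : V} → x ≢ y →
      x ≡ p ⊎ x ≡ q → y ≡ p ⊎ y ≡ q → z ≡ p ⊎ z ≡ q → z ≡ x ⊎ z ≡ y
    pigeon x≢y (inj₁ refl) (inj₁ refl) _           = ⊥-elim (x≢y refl)
    pigeon x≢y (inj₂ refl) (inj₂ refl) _           = ⊥-elim (x≢y refl)
    pigeon x≢y (inj₁ refl) (inj₂ refl) (inj₁ refl) = inj₁ refl
    pigeon x≢y (inj₁ refl) (inj₂ refl) (inj₂ refl) = inj₂ refl
    pigeon x≢y (inj₂ refl) (inj₁ refl) (inj₁ refl) = inj₂ refl
    pigeon x≢y (inj₂ refl) (inj₁ refl) (inj₂ refl) = inj₁ refl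

  other-common : ∀ {u w x} → u ≢ w → ¬ u ~ w → u ~ x → w ~ x → ∃[ z ] (z ≢ x × u ~ z × w ~ z)
  other-common {x = x} u≢w u≁w u~x w~x with two-common u≢w u≁w
  ... | c with only u~x w~x
    where open TwoCommon c
  ...   | inj₁ refl = _ , (p≢q ∘ sym) , u~q , v~q
    where open TwoCommon c
  ...   | inj₂ refl = _ , p≢q , u~p , v~p
    where open TwoCommon c

  -- Powers of an automorphism.

  module Power (g : Automorphism Γ) where
    open Automorphism g

    G : ℕ → V → V
    G zero    w = w
    G (suc n) w = perm ⟨$⟩ʳ G n w

    G-~ : ∀ n {u w} → u ~ w → G n u ~ G n w
    G-~ zero    u~w = u~w
    G-~ (suc n) u~w = Equivalence.to (preserves _ _) (G-~ n u~w)

    G-~⁻ : ∀ n {u w} → G n u ~ G n w → u ~ w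
    G-~⁻ zero    u~w = u~w
    G-~⁻ (suc n) u~w = G-~⁻ n (Equivalence.from (preserves _ _) u~w)

    G-injective : ∀ n {u w} → G n u ≡ G n w → u ≡ w
    G-injective zero    eq = eq
    G-injective (suc n) eq = G-injective n
      (trans (sym (inverseˡ perm)) (trans (cong (perm ⟨$⟩ˡ_) eq) (inverseˡ perm)))

    sum-G : ∀ n (f : V → ℕ) → ∑[ w < v ] f (G n w) ≡ sum f
    sum-G zero    f = refl
    sum-G (suc n) f = trans (sum-G n (f ∘ (perm ⟨$⟩ʳ_))) (sym (sum-permute f perm))

    G-a : ∀ n u v → a (G n u) (G n v) ≡ a u v
    G-a n u v with adj? u v
    ... | yes u~v = ~⇒a≡1 (G-~ n u~v)
    ... | no  u≁v = ≁⇒a≡0 (u≁v ∘ G-~⁻ n)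

    G-+ : ∀ m n v → G (m + n) v ≡ G m (G n v)
    G-+ zero    n v = refl
    G-+ (suc m) n v = cong (perm ⟨$⟩ʳ_) (G-+ m n v)

    G-comm : ∀ m n v → G m (G n v) ≡ G n (G m v)
    G-comm m n v = trans (sym (G-+ m n v)) (trans (cong (λ k → G k v) (+-comm m n)) (G-+ n m v))

    G-multiple : ∀ k {n v} → G n v ≡ v → G (k * n) v ≡ v
    G-multiple zero        fixed = refl
    G-multiple (suc k) {n} {v} fixed =
      trans (G-+ n (k * n) v) (trans (cong (G n) (G-multiple k fixed)) fixed)

    -- If w is not joined to x, their common neighbours p and q are fixed, and nonadjacent since
    -- otherwise the edge p q would lie in two triangles. So x and w are the only common neighbours
    -- of p and q, and the image of w, being one of them, cannot be x.
    fixed-if-neighbourhood-fixed : ∀ n {x} → G n x ≡ x → (∀ {u} → x ~ u → G n u ≡ u) → ∀ w → G n w ≡ w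
    fixed-if-neighbourhood-fixed n {x} fix-x fix-N w with w ≟ x | adj? x w
    ... | yes refl | _       = fix-x
    ... | no _     | yes x~w = fix-N x~w
    ... | no w≢x   | no x≁w  = by-common-neighbours (two-common (w≢x ∘ sym) x≁w)
      where
      by-common-neighbours : TwoCommon x w → G n w ≡ w
      by-common-neighbours c = [ (λ Gw≡x → ⊥-elim (w≢x (G-injective n (trans Gw≡x (sym fix-x)))))
                               , (λ Gw≡w → Gw≡w) ]′
        (third-common p≢q p≁q (w≢x ∘ sym) (~-sym u~p) (~-sym u~q) (~-sym v~p) (~-sym v~q)
          (~-sym (move u~p v~p)) (~-sym (move u~q v~q)))
        where
        open TwoCommon c
        p≁q : ¬ p ~ q
        p≁q p~q = w≢x (mate-unique p~q (~-sym v~p) (~-sym v~q) (~-sym u~p) (~-sym u~q))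
        move : ∀ {u} → x ~ u → w ~ u → G n w ~ u
        move x~u w~u = subst (G n w ~_) (fix-N x~u) (G-~ n w~u)

    -- Fixed vertices of σ = g².

    module Order14 (G14≗id : ∀ w → G 14 w ≡ w)
                   (G2≢id : ¬ (∀ w → G 2 w ≡ w)) (G7≢id : ¬ (∀ w → G 7 w ≡ w)) where

      G-% : ∀ n w → G n w ≡ G (n % 14) w
      G-% n w = begin
        G n w                            ≡⟨ cong (λ k → G k w) (m≡m%n+[m/n]*n n 14) ⟩
        G (n % 14 + n / 14 * 14) w       ≡⟨ G-+ (n % 14) (n / 14 * 14) w ⟩
        G (n % 14) (G (n / 14 * 14) w)   ≡⟨ cong (G (n % 14)) (G-multiple (n / 14) (G14≗id w)) ⟩
        G (n % 14) w                     ∎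

      G-%≡ : ∀ m n → m % 14 ≡ n % 14 → ∀ w → G m w ≡ G n w
      G-%≡ m n eq w = trans (G-% m w) (trans (cong (λ k → G k w) eq) (sym (G-% n w)))

      -- 13 j plays the role of − j, the exponents being taken modulo 14.
      G-cancel : ∀ i j {u w} → G i u ≡ G j w → G (13 * j + i) u ≡ w
      G-cancel i j {u} {w} eq = begin
        G (13 * j + i) u     ≡⟨ G-+ (13 * j) i u ⟩
        G (13 * j) (G i u)   ≡⟨ cong (G (13 * j)) eq ⟩
        G (13 * j) (G j w)   ≡⟨ G-+ (13 * j) j w ⟨
        G (13 * j + j) w     ≡⟨ cong (λ k → G k w) (trans (+-comm (13 * j) j) (*-comm 14 j)) ⟩
        G (j * 14) w         ≡⟨ G-multiple j (G14≗id w) ⟩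
        w                    ∎

      σ : ℕ → V → V
      σ k = G (k * 2)

      σ-fixes : ∀ k {w} → G 2 w ≡ w → σ k w ≡ w
      σ-fixes k = G-multiple k

      -- If 7 does not divide i, some multiple of i is 2 modulo 14, and then g² would fix w.
      stabiliser : ∀ {w} → G 2 w ≢ w → ∀ i → G i w ≡ w → i % 14 % 7 ≡ 0
      stabiliser {w} G2w≢w i Giw≡w = subst (λ r → r % 7 ≡ 0) (toℕ-mod14 i) (decide (table r))
        where
        r = i mod 14
        table : ∀ (r : Fin 14) → toℕ r % 7 ≡ 0 ⊎ ∃[ k ] toℕ {14} k * toℕ r % 14 ≡ 2
        table = toWitness {a? = all? λ r → (_ ℕ.≟ _) ⊎-dec any? λ k → _ ℕ.≟ _} _
        decide : toℕ r % 7 ≡ 0 ⊎ ∃[ k ] toℕ {14} k * toℕ r % 14 ≡ 2 → toℕ r % 7 ≡ 0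
        decide (inj₁ eq)        = eq
        decide (inj₂ (k , k*r)) = ⊥-elim (G2w≢w (trans (sym (G-%≡ (toℕ k * toℕ r) 2 k*r w))
          (G-multiple (toℕ k) (trans (trans (cong (λ n → G n w) (toℕ-mod14 i)) (sym (G-% i w))) Giw≡w))))

      σ-injective : ∀ {w} → G 2 w ≢ w → (i j : Fin 7) → σ (toℕ i) w ≡ σ (toℕ j) w → i ≡ j
      σ-injective {w} G2w≢w i j eq = table i j
        (stabiliser G2w≢w (13 * (toℕ j * 2) + toℕ i * 2) (G-cancel (toℕ i * 2) (toℕ j * 2) eq))
        where
        table : (i j : Fin 7) → (13 * (toℕ j * 2) + toℕ i * 2) % 14 % 7 ≡ 0 → i ≡ j
        table = toWitness {a? = all? λ i → all? λ j → (_ ℕ.≟ _) →-dec (i ≟ j)} _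

      fixed-σ : ∀ k {w} → G 2 (σ k w) ≡ σ k w → G 2 w ≡ w
      fixed-σ k fixed = G-injective (k * 2) (trans (sym (G-comm 2 (k * 2) _)) fixed)

      mate-fixed : ∀ n {x u m} → G n x ≡ x → x ~ u → x ~ m → u ~ m → G n u ≡ u → G n m ≡ m
      mate-fixed n {x} {u} {m} fix-x x~u x~m u~m fix-u = mate-unique x~u
        (subst (_~ G n m) fix-x (G-~ n x~m)) (subst (_~ G n m) fix-u (G-~ n u~m)) x~m u~m

      module _ {x u m} (fix-x : G 2 x ≡ x) (x~u : x ~ u) (x~m : x ~ m) (u~m : u ~ m)
               (G2u≢u : G 2 u ≢ u) where

        private
          G2m≢m : G 2 m ≢ m
          G2m≢m fix-m = G2u≢u (mate-fixed 2 fix-x x~m x~u (~-sym u~m) fix-m)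

          -- With n = 2 (i - j) modulo 14, gⁿ would take u to m, and m back to u because it fixes x.
          -- Then g²ⁿ fixes u, so 7 divides 2 n; n being even, it is 0 modulo 14, which makes u
          -- equal to m.
          σu≢σm : (i j : Fin 7) → σ (toℕ i) u ≢ σ (toℕ j) m
          σu≢σm i j eq = ~⇒≢ u~m (trans (sym (G-%≡ n 0 n≡0 u)) Gnu≡m)
            where
            n = 13 * (toℕ j * 2) + toℕ i * 2
            Gnu≡m : G n u ≡ m
            Gnu≡m = G-cancel (toℕ i * 2) (toℕ j * 2) eq
            fix-x-n : G n x ≡ x
            fix-x-n = trans (G-+ (13 * (toℕ j * 2)) (toℕ i * 2) x)
              (trans (cong (G (13 * (toℕ j * 2))) (σ-fixes (toℕ i) fix-x))
                     (G-multiple 13 {toℕ j * 2} (σ-fixes (toℕ j) fix-x)))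
            Gnm≡u : G n m ≡ u
            Gnm≡u = mate-unique x~m
              (subst (_~ G n m) fix-x-n (G-~ n x~m)) (subst (_~ G n m) Gnu≡m (G-~ n u~m))
              x~u (~-sym u~m)
            table : (i j : Fin 7) → let n = 13 * (toℕ j * 2) + toℕ i * 2 in
                    (n + n) % 14 % 7 ≡ 0 → n % 14 ≡ 0
            table = toWitness {a? = all? λ i → all? λ j → (_ ℕ.≟ _) →-dec (_ ℕ.≟ _)} _
            n≡0 : n % 14 ≡ 0
            n≡0 = table i j (stabiliser G2u≢u (n + n)
                    (trans (G-+ n n u) (trans (cong (G n) Gnu≡m) Gnm≡u)))

          point : Fin 7 ⊎ Fin 7 → V
          point = [ (λ i → σ (toℕ i) u) , (λ j → σ (toℕ j) m) ]′

          point-injective : ∀ s t → point s ≡ point t → s ≡ t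
          point-injective (inj₁ i) (inj₁ j) eq = cong inj₁ (σ-injective G2u≢u i j eq)
          point-injective (inj₁ i) (inj₂ j) eq = ⊥-elim (σu≢σm i j eq)
          point-injective (inj₂ i) (inj₁ j) eq = ⊥-elim (σu≢σm j i (sym eq))
          point-injective (inj₂ i) (inj₂ j) eq = cong inj₂ (σ-injective G2m≢m i j eq)

          x~point : ∀ s → x ~ point s
          x~point (inj₁ i) = subst (_~ _) (σ-fixes (toℕ i) fix-x) (G-~ (toℕ i * 2) x~u)
          x~point (inj₂ j) = subst (_~ _) (σ-fixes (toℕ j) fix-x) (G-~ (toℕ j * 2) x~m)

        -- The σ-orbits of u and m are disjoint and have 7 elements each, which exhausts the 14
        -- neighbours of x.
        neighbourhood-two-orbits : ∀ {y} → x ~ y → ∃[ k ] (σ k u ≡ y ⊎ σ k m ≡ y)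
        neighbourhood-two-orbits {y} x~y with injective⇒covers (a x)
          (splitAt-injective 7 ∘ point-injective _ _)
          (λ i → subst (0 <_) (sym (~⇒a≡1 (x~point (splitAt 7 i)))) z<s)
          (degree x) y (subst (0 <_) (sym (~⇒a≡1 x~y)) z<s)
        ... | i , eq = orbit (splitAt 7 i) eq
          where
          orbit : ∀ s → point s ≡ y → ∃[ k ] (σ k u ≡ y ⊎ σ k m ≡ y)
          orbit (inj₁ i) eq = toℕ i , inj₁ eq
          orbit (inj₂ j) eq = toℕ j , inj₂ eq

      -- If σ moved a neighbour of x, the two orbits covering the neighbourhood would contain no
      -- fixed vertex, yet y is one. So the whole neighbourhood is fixed and σ is trivial.
      fixed⇒¬~fixed : ∀ {x y} → G 2 x ≡ x → G 2 y ≡ y → ¬ x ~ y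
      fixed⇒¬~fixed {x} {y} fix-x fix-y x~y =
        G2≢id (fixed-if-neighbourhood-fixed 2 fix-x fix-N)
        where
        fix-N : ∀ {u} → x ~ u → G 2 u ≡ u
        fix-N {u} x~u with G 2 u ≟ u
        ... | yes fix-u = fix-u
        ... | no  G2u≢u with mate x~u
        ...   | m , x~m , u~m with neighbourhood-two-orbits fix-x x~u x~m u~m G2u≢u x~y
        ...     | k , inj₁ refl = fixed-σ k fix-y
        ...     | k , inj₂ refl = mate-fixed 2 fix-x x~m x~u (~-sym u~m) (fixed-σ k fix-y)

      -- For nonadjacent x and y, σ permutes their two common neighbours. It cannot swap them, so it
      -- fixes one, which is a fixed neighbour of x.
      fixed-unique : ∀ {x y} → G 2 x ≡ x → G 2 y ≡ y → x ≡ y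
      fixed-unique {x} {y} fix-x fix-y with x ≟ y | adj? x y
      ... | yes x≡y | _       = x≡y
      ... | no _    | yes x~y = ⊥-elim (fixed⇒¬~fixed fix-x fix-y x~y)
      ... | no x≢y  | no x≁y  = ⊥-elim (fixed⇒¬~fixed fix-x fix-p u~p)
        where
        open TwoCommon (two-common x≢y x≁y)
        image-common : ∀ {w} → x ~ w → y ~ w → G 2 w ≡ p ⊎ G 2 w ≡ q
        image-common x~w y~w = only (subst (_~ _) fix-x (G-~ 2 x~w)) (subst (_~ _) fix-y (G-~ 2 y~w))
        fix-p : G 2 p ≡ p
        fix-p with image-common u~p v~p | image-common u~q v~q
        ... | inj₁ eq | _       = eq
        ... | inj₂ Gp≡q | inj₂ Gq≡q = ⊥-elim (p≢q (G-injective 2 (trans Gp≡q (sym Gq≡q))))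
        ... | inj₂ Gp≡q | inj₁ Gq≡p with G 2 p ≟ p
        ...   | yes eq = eq
        -- A swap makes g⁴ fix p, but 4 is not a multiple of 7.
        ...   | no G2p≢p with () ← stabiliser G2p≢p 4 (trans (cong (G 2) Gp≡q) Gq≡p)

      σ-σ : ∀ i j k w → (i * 2 + j * 2) % 14 ≡ k * 2 % 14 → σ i (σ j w) ≡ σ k w
      σ-σ i j k w eq = trans (sym (G-+ (i * 2) (j * 2) w)) (G-%≡ (i * 2 + j * 2) (k * 2) eq w)

      -- A σ-orbit of size 7 has exactly one least element, so without fixed points the least
      -- elements number v / 7.
      Least : V → Set
      Least w = ∀ i → toℕ w ≤ toℕ (σ (toℕ {7} i) w)

      least? : ∀ w → Dec (Least w)
      least? w = all? (λ i → toℕ w ≤? toℕ (σ (toℕ i) w))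

      least : V → ℕ
      least w = indicator (does (least? w))

      least-exists : ∀ w → ∃[ i ] (Least (σ (toℕ {7} i) w) × (∀ j → toℕ (σ (toℕ i) w) ≤ toℕ (σ (toℕ {7} j) w)))
      least-exists w = let i , min = argmin (λ i → toℕ (σ (toℕ {7} i) w)) in i , minimal i min , min
        where
        addition : (i j : Fin 7) → ∃[ k ] (toℕ i * 2 + toℕ j * 2) % 14 ≡ toℕ {7} k * 2 % 14
        addition = toWitness {a? = all? λ i → all? λ j → any? λ k → _ ℕ.≟ _} _
        minimal : ∀ i → (∀ j → toℕ (σ (toℕ i) w) ≤ toℕ (σ (toℕ {7} j) w)) → Least (σ (toℕ {7} i) w)
        minimal i min j = go (addition j i)
          where
          go : ∃[ k ] (toℕ j * 2 + toℕ i * 2) % 14 ≡ toℕ {7} k * 2 % 14 → toℕ (σ (toℕ i) w) ≤ toℕ (σ (toℕ j) (σ (toℕ i) w))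
          go (k , eq) = subst (λ u → toℕ (σ (toℕ i) w) ≤ toℕ u) (sym (σ-σ (toℕ j) (toℕ i) (toℕ k) w eq)) (min k)

      least-unique : ∀ {w} → G 2 w ≢ w → ∀ i → (∀ j → toℕ (σ (toℕ i) w) ≤ toℕ (σ (toℕ {7} j) w)) →
        ∀ j → Least (σ (toℕ {7} j) w) → i ≡ j
      least-unique {w} G2w≢w i min j below = go (difference i j)
        where
        difference : (i j : Fin 7) → ∃[ k ] (toℕ {7} k * 2 + toℕ j * 2) % 14 ≡ toℕ i * 2 % 14
        difference = toWitness {a? = all? λ i → all? λ j → any? λ k → _ ℕ.≟ _} _
        go : ∃[ k ] (toℕ {7} k * 2 + toℕ j * 2) % 14 ≡ toℕ i * 2 % 14 → i ≡ j
        go (k , eq) = σ-injective G2w≢w i j (Fin.toℕ-injective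
            (≤-antisym (min j) (subst (λ u → toℕ (σ (toℕ j) w) ≤ toℕ u) (σ-σ (toℕ k) (toℕ j) (toℕ i) w eq) (below k))))

      one-least : ∀ {w} → G 2 w ≢ w → ∑[ i < 7 ] least (σ (toℕ i) w) ≡ 1
      one-least {w} G2w≢w = go (least-exists w)
        where
        go : ∃[ i ] (Least (σ (toℕ {7} i) w) × (∀ j → toℕ (σ (toℕ i) w) ≤ toℕ (σ (toℕ {7} j) w))) →
          ∑[ i < 7 ] least (σ (toℕ i) w) ≡ 1
        go (i , minimal , min) = sum-one i
            (cong indicator (dec-true (least? (σ (toℕ i) w)) minimal))
            (λ j i≢j → cong indicator (dec-false (least? (σ (toℕ j) w)) (i≢j ∘ least-unique G2w≢w i min j)))

      -- Pairs (w, i) with σⁱ w least are counted twice: one for each w, and as many for each i as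
      -- there are least elements.
      free⇒7∣v : (∀ w → G 2 w ≢ w) → 7 ∣ v
      free⇒7∣v free = divides (sum least) (begin
          v                                         ≡⟨ trans (sum-const v 1) (*-identityʳ v) ⟨
          ∑[ w < v ] 1                              ≡⟨ sum-cong-≗ {v} (λ w → sym (one-least (free w))) ⟩
          ∑[ w < v ] ∑[ i < 7 ] least (σ (toℕ i) w) ≡⟨ ∑-comm {v} {7} (λ w i → least (σ (toℕ i) w)) ⟩
          ∑[ i < 7 ] ∑[ w < v ] least (σ (toℕ i) w) ≡⟨ sum-cong-≗ {7} (λ i → sum-G (toℕ i * 2) least) ⟩
          ∑[ i < 7 ] sum least                      ≡⟨ trans (sum-const 7 (sum least)) (*-comm 7 (sum least)) ⟩
          sum least * 7                             ∎)

      fixed-exists : ¬ 7 ∣ v → ∃[ x ] G 2 x ≡ x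
      fixed-exists 7∤v = decidable-stable (any? (λ x → G 2 x ≟ x))
        (λ absent → 7∤v (free⇒7∣v (λ w fixed → absent (w , fixed))))

      -- The fixed vertex x and the 14-cycle on its neighbours.

      module Centre (v≡99 : v ≡ 99) {x a₀ m₀ : V} (fix-x : G 2 x ≡ x)
        (x~a₀ : x ~ a₀) (x~m₀ : x ~ m₀) (a₀~m₀ : a₀ ~ m₀) where

        -- The image of x under g is again fixed by g², hence equals x by uniqueness.
        G-x : ∀ n → G n x ≡ x
        G-x n = subst (λ k → G k x ≡ x) (*-identityʳ n)
          (G-multiple n {1} (fixed-unique (trans (G-comm 2 1 x) (cong (G 1) fix-x)) fix-x))

        p : ℕ → V
        p i = G i a₀

        x~p : ∀ i → x ~ p i
        x~p i = subst (_~ p i) (G-x i) (G-~ i x~a₀)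

        G2a₀≢a₀ : G 2 a₀ ≢ a₀
        G2a₀≢a₀ fix-a₀ = fixed⇒¬~fixed fix-x fix-a₀ x~a₀

        -- If g⁷ fixed a₀ it would fix the mate m₀ too and, commuting with σ, every neighbour of x;
        -- then it would be trivial.
        G7a₀≢a₀ : G 7 a₀ ≢ a₀
        G7a₀≢a₀ fix-a₀ = G7≢id (fixed-if-neighbourhood-fixed 7 (G-x 7) fix-N)
          where
          fix-N : ∀ {y} → x ~ y → G 7 y ≡ y
          fix-N x~y = go (neighbourhood-two-orbits fix-x x~a₀ x~m₀ a₀~m₀ G2a₀≢a₀ x~y)
            where
            go : ∀ {y} → ∃[ k ] (σ k a₀ ≡ y ⊎ σ k m₀ ≡ y) → G 7 y ≡ y
            go (k , inj₁ refl) = trans (G-comm 7 (k * 2) a₀) (cong (σ k) fix-a₀)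
            go (k , inj₂ refl) = trans (G-comm 7 (k * 2) m₀)
              (cong (σ k) (mate-fixed 7 (G-x 7) x~a₀ x~m₀ a₀~m₀ fix-a₀))

        p-free : ∀ n → p n ≡ a₀ → n % 14 ≡ 0
        p-free n pn≡a₀ = decide (table (n mod 14)
            (subst (λ r → r % 7 ≡ 0) (sym (toℕ-mod14 n)) (stabiliser G2a₀≢a₀ n pn≡a₀)))
          where
          table : (r : Fin 14) → toℕ r % 7 ≡ 0 → toℕ r ≡ 0 ⊎ toℕ r ≡ 7
          table = toWitness {a? = all? λ r → (_ ℕ.≟ _) →-dec ((_ ℕ.≟ _) ⊎-dec (_ ℕ.≟ _))} _
          decide : toℕ (n mod 14) ≡ 0 ⊎ toℕ (n mod 14) ≡ 7 → n % 14 ≡ 0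
          decide (inj₁ eq) = trans (sym (toℕ-mod14 n)) eq
          decide (inj₂ eq) = ⊥-elim (G7a₀≢a₀
            (trans (sym (G-%≡ n 7 (trans (sym (toℕ-mod14 n)) eq) a₀)) pn≡a₀))

        p-injective : (i j : Fin 14) → p (toℕ i) ≡ p (toℕ j) → i ≡ j
        p-injective i j eq = table i j (p-free (13 * toℕ j + toℕ i) (G-cancel (toℕ i) (toℕ j) eq))
          where
          table : (i j : Fin 14) → (13 * toℕ j + toℕ i) % 14 ≡ 0 → i ≡ j
          table = toWitness {a? = all? λ i → all? λ j → (_ ℕ.≟ _) →-dec (_ ≟ _)} _

        p-covers : ∀ {y} → x ~ y → ∃[ i ] p (toℕ {14} i) ≡ y
        p-covers {y} x~y = injective⇒covers (a x) (p-injective _ _)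
          (λ i → subst (0 <_) (sym (~⇒a≡1 (x~p (toℕ i)))) z<s)
          (degree x) y (subst (0 <_) (sym (~⇒a≡1 x~y)) z<s)

        -- Let m₀ = p k. Then gᵏ interchanges a₀ and m₀, so 2 k is 0 modulo 14, and k = 0 is
        -- impossible.
        a₀~p7 : a₀ ~ p 7
        a₀~p7 = go (p-covers x~m₀)
          where
          table : (k : Fin 14) → (toℕ k + toℕ k) % 14 ≡ 0 → toℕ k ≡ 0 ⊎ toℕ k ≡ 7
          table = toWitness {a? = all? λ k → (_ ℕ.≟ _) →-dec ((_ ℕ.≟ _) ⊎-dec (_ ℕ.≟ _))} _
          go : ∃[ k ] p (toℕ {14} k) ≡ m₀ → a₀ ~ p 7
          go (k , pk≡m₀) = decide (table k (p-free (toℕ k + toℕ k) Gkk))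
            where
            Gkm₀≡a₀ : G (toℕ k) m₀ ≡ a₀
            Gkm₀≡a₀ = mate-unique x~m₀
              (subst (_~ G (toℕ k) m₀) (G-x (toℕ k)) (G-~ (toℕ k) x~m₀))
              (subst (_~ G (toℕ k) m₀) pk≡m₀ (G-~ (toℕ k) a₀~m₀)) x~a₀ (~-sym a₀~m₀)
            Gkk : p (toℕ k + toℕ k) ≡ a₀
            Gkk = trans (G-+ (toℕ k) (toℕ k) a₀) (trans (cong (G (toℕ k)) pk≡m₀) Gkm₀≡a₀)
            decide : toℕ k ≡ 0 ⊎ toℕ k ≡ 7 → a₀ ~ p 7
            decide (inj₁ eq) = ⊥-elim (~⇒≢ a₀~m₀ (trans (cong p (sym eq)) pk≡m₀))
            decide (inj₂ eq) = subst (a₀ ~_) (trans (sym pk≡m₀) (cong p eq)) a₀~m₀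

        -- Translating the edge from a₀ to p 7 gives one from p j to p (j + 7); a second one would
        -- put the edge from x to p j in two triangles.
        a-p-p : ∀ j i → a (p (toℕ j)) (p (toℕ i)) ≡ codeᵖ j i
        a-p-p j i = trans (go ((toℕ j + 7) % 14 ℕ.≟ toℕ i)) (sym (codeᵖ≡ j i))
          where
          Gj-p7 : G (toℕ j) (p 7) ≡ p ((toℕ j + 7) % 14)
          Gj-p7 = trans (sym (G-+ (toℕ j) 7 a₀)) (G-% (toℕ j + 7) a₀)
          pj~Gj-p7 : p (toℕ j) ~ p ((toℕ j + 7) % 14)
          pj~Gj-p7 = subst (p (toℕ j) ~_) Gj-p7 (G-~ (toℕ j) a₀~p7)
          go : (d : Dec ((toℕ j + 7) % 14 ≡ toℕ i)) → a (p (toℕ j)) (p (toℕ i)) ≡ indicator (does d)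
          go (yes eq) = ~⇒a≡1 (subst (λ k → p (toℕ j) ~ p k) eq pj~Gj-p7)
          go (no neq) = ≁⇒a≡0 λ pj~pi → neq (trans (sym (toℕ-mod14 (toℕ j + 7))) (cong toℕ
            (p-injective ((toℕ j + 7) mod 14) i (trans (cong p (toℕ-mod14 (toℕ j + 7)))
              (mate-unique (x~p (toℕ j)) (x~p ((toℕ j + 7) % 14)) pj~Gj-p7 (x~p (toℕ i)) pj~pi)))))

        a₀≢p : ∀ s → a₀ ≢ p (toℕ (offset s))
        a₀≢p s eq = Fin.0≢1+n (p-injective zero (offset s) eq)

        a₀≁p : ∀ s → ¬ a₀ ~ p (toℕ (offset s))
        a₀≁p s a₀~p = ℕ.0≢1+n (trans (sym (codeᵖ-offset s)) (trans (sym (a-p-p zero (offset s))) (~⇒a≡1 a₀~p)))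

        opposite : ∀ s → ∃[ z ] (z ≢ x × a₀ ~ z × p (toℕ (offset s)) ~ z)
        opposite s = other-common (a₀≢p s) (a₀≁p s) (~-sym x~a₀) (~-sym (x~p (toℕ (offset s))))

        -- The six regular orbits and their matrix R.

        module Orbits (z : Fin 6 → V) (z≢x : ∀ s → z s ≢ x)
          (a₀~z : ∀ s → a₀ ~ z s) (p~z : ∀ s → p (toℕ (offset s)) ~ z s) where

          -- Otherwise a₀ and p (s + 1) would both complete the edge from z s to x to a triangle.
          z≁x : ∀ s → ¬ z s ~ x
          z≁x s z~x = a₀≢p s (mate-unique (~-sym z~x) x~a₀ (~-sym (a₀~z s)) (x~p (toℕ (offset s))) (~-sym (p~z s)))

          a-z-p : ∀ s k → a (z s) (p (toℕ k)) ≡ codeᶻ s k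
          a-z-p s k = trans (go (k ≟ zero) (k ≟ offset s)) (sym (codeᶻ≡ s k))
            where
            go : (d : Dec (k ≡ zero)) (e : Dec (k ≡ offset s)) →
              a (z s) (p (toℕ k)) ≡ indicator (does d ∨ does e)
            go (yes refl) _          = ~⇒a≡1 (~-sym (a₀~z s))
            go (no _)     (yes refl) = ~⇒a≡1 (~-sym (p~z s))
            go (no k≢0)   (no k≢s)   = ≁⇒a≡0 λ z~pk → [ k≢0 ∘ p-injective k zero , k≢s ∘ p-injective k (offset s) ]′
              (third-common (z≢x s) (z≁x s) (a₀≢p s) (~-sym (a₀~z s)) x~a₀
                (~-sym (p~z s)) (x~p (toℕ (offset s))) z~pk (x~p (toℕ k)))

          vertex : Index → V
          vertex (inj₁ zero)    = x
          vertex (inj₁ (suc i)) = p (toℕ i)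
          vertex (inj₂ (s , j)) = G (toℕ j) (z s)

          a-vertex-p : ∀ c i → a (vertex c) (p (toℕ i)) ≡ code c i
          a-vertex-p (inj₁ zero)    i = ~⇒a≡1 (x~p (toℕ i))
          a-vertex-p (inj₁ (suc j)) i = a-p-p j i
          a-vertex-p (inj₂ (s , j)) i = begin
            a (G (toℕ j) (z s)) (p (toℕ i))                     ≡⟨ cong (a (G (toℕ j) (z s)))
              (trans (sym (G-%≡ (toℕ j + toℕ (i ⊖ j)) (toℕ i) (⊖-+ i j) a₀)) (G-+ (toℕ j) (toℕ (i ⊖ j)) a₀)) ⟩
            a (G (toℕ j) (z s)) (G (toℕ j) (p (toℕ (i ⊖ j))))   ≡⟨ G-a (toℕ j) _ _ ⟩
            a (z s) (p (toℕ (i ⊖ j)))                           ≡⟨ a-z-p s (i ⊖ j) ⟩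
            codeᶻ s (i ⊖ j)                                     ∎

          vertex-injective : ∀ {c c′} → vertex c ≡ vertex c′ → c ≡ c′
          vertex-injective {c} {c′} eq = code-injective c c′ λ i →
            trans (sym (a-vertex-p c i)) (trans (cong (λ w → a w (p (toℕ i))) eq) (a-vertex-p c′ i))

          split-sum : ∀ f → sum f ≡ f x + ∑[ i < 14 ] f (p (toℕ i)) + ∑[ s < 6 ] ∑[ j < 14 ] f (G (toℕ j) (z s))
          split-sum = sum-partition 15 6 14 vertex vertex-injective v≡99

          R : Fin 6 → Fin 6 → ℕ
          R s t = ∑[ j < 14 ] a (z s) (G (toℕ j) (z t))

          -- Shifting the cyclic summation index by i lets gⁱ be cancelled from both arguments, so
          -- every vertex of orbit s gives the same count.
          R-translate : ∀ s t i → ∑[ j < 14 ] a (G i (z s)) (G (toℕ j) (z t)) ≡ R s t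
          R-translate s t i = trans
            (sym (∑-rotate 14 F (λ k → cong (a (G i (z s))) (trans (G-+ 14 k (z t)) (G14≗id (G k (z t))))) i))
            (sum-cong-≗ {14} λ j → trans
              (cong (a (G i (z s))) (trans (cong (λ k → G k (z t)) (+-comm (toℕ j) i)) (G-+ i (toℕ j) (z t))))
              (G-a i (z s) (G (toℕ j) (z t))))
            where
            F : ℕ → ℕ
            F n = a (G i (z s)) (G n (z t))

          -- The adjacent pairs between orbits s and t, counted from either side, number 14 times
          -- the respective entry.
          R-sym : ∀ s t → R s t ≡ R t s
          R-sym s t = *-cancelˡ-≡ (R s t) (R t s) 14 (begin
            14 * R s t                                                             ≡⟨ sum-const 14 (R s t) ⟨
            ∑[ i < 14 ] R s t                                                      ≡⟨ sum-cong-≗ {14} (λ i → R-translate s t (toℕ i)) ⟨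
            ∑[ i < 14 ] ∑[ j < 14 ] a (G (toℕ i) (z s)) (G (toℕ j) (z t))          ≡⟨ ∑-comm {14} {14} (λ i j → a (G (toℕ i) (z s)) (G (toℕ j) (z t))) ⟩
            ∑[ j < 14 ] ∑[ i < 14 ] a (G (toℕ i) (z s)) (G (toℕ j) (z t))          ≡⟨ sum-cong-≗ {14} (λ j → trans
              (sum-cong-≗ {14} λ i → a-sym (G (toℕ i) (z s)) (G (toℕ j) (z t))) (R-translate t s (toℕ j))) ⟩
            ∑[ j < 14 ] R t s                                                      ≡⟨ sum-const 14 (R t s) ⟩
            14 * R t s                                                             ∎)

          neighbour-sum : ∀ s (f : V → ℕ) → ∑[ w < v ] (a (z s) w * f w) ≡
            ∑[ i < 14 ] (codeᶻ s i * f (p (toℕ i))) + ∑[ t < 6 ] ∑[ j < 14 ] (a (z s) (G (toℕ j) (z t)) * f (G (toℕ j) (z t)))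
          neighbour-sum s f = trans (split-sum (λ w → a (z s) w * f w))
            (cong (_+ ∑[ t < 6 ] ∑[ j < 14 ] (a (z s) (G (toℕ j) (z t)) * f (G (toℕ j) (z t))))
              (cong₂ _+_ (cong (_* f x) (≁⇒a≡0 (z≁x s)))
                (sum-cong-≗ {14} λ i → cong (_* f (p (toℕ i))) (a-z-p s i))))

          row-sum : ∀ s → ∑[ t < 6 ] R s t ≡ 12
          row-sum s = +-cancelˡ-≡ 2 _ _ (begin
            2 + ∑[ t < 6 ] R s t
              ≡⟨ cong₂ _+_ (sym (codeᶻ-sum s 1)) (sum-cong-≗ {6} λ t → sum-cong-≗ {14} λ j → sym (*-identityʳ (a (z s) (G (toℕ j) (z t))))) ⟩
            ∑[ i < 14 ] (codeᶻ s i * 1) + ∑[ t < 6 ] ∑[ j < 14 ] (a (z s) (G (toℕ j) (z t)) * 1)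
              ≡⟨ neighbour-sum s (λ _ → 1) ⟨
            ∑[ w < v ] (a (z s) w * 1)
              ≡⟨ sum-cong-≗ {v} (λ w → *-identityʳ (a (z s) w)) ⟩
            ∑[ w < v ] a (z s) w
              ≡⟨ degree (z s) ⟩
            14 ∎)

          orbitCount : Fin 6 → V → ℕ
          orbitCount t w = ∑[ j < 14 ] a (G (toℕ j) (z t)) w

          orbitCount-p : ∀ t i → orbitCount t (p (toℕ i)) ≡ 2
          orbitCount-p t i = trans
            (sum-cong-≗ {14} {λ j → a (vertex (inj₂ (t , j))) (p (toℕ i))} {λ j → code (inj₂ (t , j)) i}
              λ j → a-vertex-p (inj₂ (t , j)) i) (code-column t i)

          orbitCount-z : ∀ t u i → orbitCount t (G i (z u)) ≡ R t u
          orbitCount-z t u i = trans (sum-cong-≗ {14} λ j → a-sym (G (toℕ j) (z t)) (G i (z u)))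
            (trans (R-translate u t i) (R-sym u t))

          -- Sums the entries of A² + A from z s to the members of orbit t. The 4 counts paths
          -- through p 0 and p (s + 1), each having two neighbours in orbit t.
          R-product : ∀ s t → ∑[ u < 6 ] (R s u * R t u) + R s t + 4 ≡
            ∑[ j < 14 ] (2 + 12 * δ (z s) (G (toℕ j) (z t)))
          R-product s t = begin
            ∑[ u < 6 ] (R s u * R t u) + R s t + 4
              ≡⟨ +-comm (∑[ u < 6 ] (R s u * R t u) + R s t) 4 ⟩
            4 + (∑[ u < 6 ] (R s u * R t u) + R s t)
              ≡⟨ +-assoc 4 (∑[ u < 6 ] (R s u * R t u)) (R s t) ⟨
            4 + ∑[ u < 6 ] (R s u * R t u) + R s t
              ≡⟨ cong (_+ R s t) (begin
                4 + ∑[ u < 6 ] (R s u * R t u)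
                  ≡⟨ cong₂ _+_
                    (trans (sym (codeᶻ-sum s 2)) (sum-cong-≗ {14} λ i → cong (codeᶻ s i *_) (sym (orbitCount-p t i))))
                    (sum-cong-≗ {6} λ u → trans (*-distribʳ-sum {14} (R t u) (λ i → a (z s) (G (toℕ i) (z u))))
                      (sum-cong-≗ {14} λ i → cong (a (z s) (G (toℕ i) (z u)) *_) (sym (orbitCount-z t u (toℕ i))))) ⟩
                ∑[ i < 14 ] (codeᶻ s i * orbitCount t (p (toℕ i)))
                  + ∑[ u < 6 ] ∑[ i < 14 ] (a (z s) (G (toℕ i) (z u)) * orbitCount t (G (toℕ i) (z u)))
                  ≡⟨ neighbour-sum s (orbitCount t) ⟨
                ∑[ w < v ] (a (z s) w * orbitCount t w)
                  ≡⟨ sum-cong-≗ {v} (λ w → *-distribˡ-sum {14} (a (z s) w) (λ j → a (G (toℕ j) (z t)) w)) ⟩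
                ∑[ w < v ] ∑[ j < 14 ] (a (z s) w * a (G (toℕ j) (z t)) w)
                  ≡⟨ ∑-comm {v} {14} (λ w j → a (z s) w * a (G (toℕ j) (z t)) w) ⟩
                ∑[ j < 14 ] ∑[ w < v ] (a (z s) w * a (G (toℕ j) (z t)) w) ∎) ⟩
            ∑[ j < 14 ] ∑[ w < v ] (a (z s) w * a (G (toℕ j) (z t)) w) + R s t
              ≡⟨ ∑-distrib-+ {14} (λ j → ∑[ w < v ] (a (z s) w * a (G (toℕ j) (z t)) w)) (λ j → a (z s) (G (toℕ j) (z t))) ⟨
            ∑[ j < 14 ] (∑[ w < v ] (a (z s) w * a (G (toℕ j) (z t)) w) + a (z s) (G (toℕ j) (z t)))
              ≡⟨ sum-cong-≗ {14} (λ j → adjacency-square (z s) (G (toℕ j) (z t))) ⟩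
            ∑[ j < 14 ] (2 + 12 * δ (z s) (G (toℕ j) (z t))) ∎

          δ-vertex : ∀ c c′ → c ≢ c′ → δ (vertex c) (vertex c′) ≡ 0
          δ-vertex c c′ c≢c′ = cong indicator (dec-false (vertex c ≟ vertex c′) (c≢c′ ∘ vertex-injective))

          -- The right side of `R-product` is 14 · 2 = 24 + 4, distinct orbits being disjoint.
          off-diagonal : ∀ s t → s ≢ t → ∑[ u < 6 ] (R s u * R t u) + R s t ≡ 24
          off-diagonal s t s≢t = +-cancelʳ-≡ 4 _ 24 (trans (R-product s t)
            (sum-cong-≗ {14} {_} {λ _ → 2} λ j → cong (λ n → 2 + 12 * n)
              (δ-vertex (inj₂ (s , zero)) (inj₂ (t , j)) λ { refl → s≢t refl })))

          -- Only j = 0 returns to z s, so the right side of `R-product` is 28 + 12 = 36 + 4.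
          diagonal : ∀ s → ∑[ u < 6 ] (R s u * R s u) + R s s ≡ 36
          diagonal s = +-cancelʳ-≡ 4 _ 36 (trans (R-product s s)
            (cong₂ _+_ (cong (λ n → 2 + 12 * n) (cong indicator (dec-true (z s ≟ z s) refl)))
              (sum-cong-≗ {13} {_} {λ _ → 2} λ j → cong (λ n → 2 + 12 * n)
                (δ-vertex (inj₂ (s , zero)) (inj₂ (s , suc j)) λ ()))))

          evenNeighbours : V → ℕ
          evenNeighbours w = ∑[ i < 14 ] (even i * a (p (toℕ i)) w)

          evenNeighbours-vertex : ∀ c → evenNeighbours (vertex c) ≡ evenCount c
          evenNeighbours-vertex c = sum-cong-≗ {14} λ i →
            cong (even i *_) (trans (a-sym (p (toℕ i)) (vertex c)) (a-vertex-p c i))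

          -- The entry of A² + A at (z s, p i) is 2 for each of the seven even i.
          even-total : ∀ s → ∑[ w < v ] (a (z s) w * evenNeighbours w) + ∑[ i < 14 ] (even i * codeᶻ s i) ≡ 14
          even-total s = begin
            ∑[ w < v ] (a (z s) w * evenNeighbours w) + ∑[ i < 14 ] (even i * codeᶻ s i)
              ≡⟨ cong₂ _+_
                (trans (sum-cong-≗ {v} λ w → trans (*-distribˡ-sum {14} (a (z s) w) (λ i → even i * a (p (toℕ i)) w))
                         (sum-cong-≗ {14} λ i → CommutativeSemigroup.x∙yz≈y∙xz *-commutativeSemigroup (a (z s) w) (even i) (a (p (toℕ i)) w)))
                  (trans (∑-comm {v} {14} (λ w i → even i * (a (z s) w * a (p (toℕ i)) w)))
                    (sum-cong-≗ {14} λ i → sym (*-distribˡ-sum {v} (even i) (λ w → a (z s) w * a (p (toℕ i)) w)))))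
                (sum-cong-≗ {14} λ i → cong (even i *_) (sym (a-z-p s i))) ⟩
            ∑[ i < 14 ] (even i * ∑[ w < v ] (a (z s) w * a (p (toℕ i)) w)) + ∑[ i < 14 ] (even i * a (z s) (p (toℕ i)))
              ≡⟨ ∑-distrib-+ {14} (λ i → even i * ∑[ w < v ] (a (z s) w * a (p (toℕ i)) w)) (λ i → even i * a (z s) (p (toℕ i))) ⟨
            ∑[ i < 14 ] (even i * ∑[ w < v ] (a (z s) w * a (p (toℕ i)) w) + even i * a (z s) (p (toℕ i)))
              ≡⟨ sum-cong-≗ {14} (λ i → trans
                (sym (*-distribˡ-+ (even i) (∑[ w < v ] (a (z s) w * a (p (toℕ i)) w)) (a (z s) (p (toℕ i)))))
                (cong (even i *_) (trans (adjacency-square (z s) (p (toℕ i)))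
                  (cong (λ n → 2 + 12 * n) (δ-vertex (inj₂ (s , zero)) (inj₁ (suc i)) λ ()))))) ⟩
            ∑[ i < 14 ] (even i * 2) ≡⟨⟩
            14 ∎

          pairTotal : Fin 6 → ℕ
          pairTotal s = ∑[ t < 6 ] ∑[ j < 14 ] (a (z s) (G (toℕ j) (z t)) * pairs t j)

          evenNeighbours-sum : ∀ s → ∑[ w < v ] (a (z s) w * evenNeighbours w) ≡
            ∑[ k < 14 ] (codeᶻ s k * evenCount (inj₁ (suc k))) + (∑[ t < 6 ] (odd t * R s t) + pairTotal s * 2)
          evenNeighbours-sum s = trans (neighbour-sum s evenNeighbours) (cong₂ _+_
            (sum-cong-≗ {14} λ k → cong (codeᶻ s k *_) (evenNeighbours-vertex (inj₁ (suc k))))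
            (begin
              ∑[ t < 6 ] ∑[ j < 14 ] (A t j * evenNeighbours (G (toℕ j) (z t)))
                ≡⟨ sum-cong-≗ {6} (λ t → trans
                  (sum-cong-≗ {14} λ j → trans (cong (A t j *_) (trans (evenNeighbours-vertex (inj₂ (t , j))) (evenCount-z t j)))
                    (trans (*-distribˡ-+ (A t j) (odd t) (pairs t j * 2))
                      (cong₂ _+_ (*-comm (A t j) (odd t)) (sym (*-assoc (A t j) (pairs t j) 2)))))
                  (trans (∑-distrib-+ {14} (λ j → odd t * A t j) (λ j → A t j * pairs t j * 2))
                    (cong₂ _+_ (sym (*-distribˡ-sum {14} (odd t) (A t)))
                               (sym (*-distribʳ-sum {14} 2 (λ j → A t j * pairs t j)))))) ⟩
              ∑[ t < 6 ] (odd t * R s t + ∑[ j < 14 ] (A t j * pairs t j) * 2)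
                ≡⟨ ∑-distrib-+ {6} (λ t → odd t * R s t) (λ t → ∑[ j < 14 ] (A t j * pairs t j) * 2) ⟩
              ∑[ t < 6 ] (odd t * R s t) + ∑[ t < 6 ] (∑[ j < 14 ] (A t j * pairs t j) * 2)
                ≡⟨ cong (∑[ t < 6 ] (odd t * R s t) +_) (sym (*-distribʳ-sum {6} 2 (λ t → ∑[ j < 14 ] (A t j * pairs t j)))) ⟩
              ∑[ t < 6 ] (odd t * R s t) + pairTotal s * 2 ∎))
            where
            A : Fin 6 → Fin 14 → ℕ
            A t j = a (z s) (G (toℕ j) (z t))

          -- Of the total 14, the points p 0 and p (s + 1) account for 2. The remaining 12 is `O`
          -- plus the even number `T`.
          odd-part-even : ∀ s → 2 ∣ ∑[ t < 6 ] (odd t * R s t)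
          odd-part-even s = ∣m+n∣m⇒∣n {m = T} (divides 6 (+-cancelʳ-≡ 2 (T + O) 12 (begin
            T + O + 2         ≡⟨ cong₂ _+_ (+-comm T O) (sym (evenCount-neighbours s)) ⟩
            O + T + (C + D)   ≡⟨ +-assoc (O + T) C D ⟨
            O + T + C + D     ≡⟨ cong (_+ D) (+-comm (O + T) C) ⟩
            C + (O + T) + D   ≡⟨ cong (_+ D) (evenNeighbours-sum s) ⟨
            ∑[ w < v ] (a (z s) w * evenNeighbours w) + D ≡⟨ even-total s ⟩
            14                ∎))) (divides (pairTotal s) refl)
            where
            O T C D : ℕ
            O = ∑[ t < 6 ] (odd t * R s t)
            T = pairTotal s * 2
            C = ∑[ k < 14 ] (codeᶻ s k * evenCount (inj₁ (suc k)))
            D = ∑[ i < 14 ] (even i * codeᶻ s i)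

          no-orbits : ⊥
          no-orbits = no-orbit-matrix R R-sym row-sum diagonal off-diagonal odd-part-even

        no-symmetry : ⊥
        no-symmetry = Orbits.no-orbits (λ s → proj₁ (opposite s)) (λ s → proj₁ (proj₂ (opposite s)))
          (λ s → proj₁ (proj₂ (proj₂ (opposite s)))) (λ s → proj₂ (proj₂ (proj₂ (opposite s))))

      no-automorphism : v ≡ 99 → ⊥
      no-automorphism v≡99 =
        let x , fix-x       = fixed-exists (λ 7∣v → from-no (7 ∣? 99) (subst (7 ∣_) v≡99 7∣v))
            a₀ , pos        = sum-positive {f = a x} (subst (0 <_) (sym (degree x)) z<s)
            m₀ , x~m₀ , a₀~m₀ = mate (0<a⇒~ x a₀ pos)
        in Centre.no-symmetry v≡99 fix-x (0<a⇒~ x a₀ pos) x~m₀ a₀~m₀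

-- From iterates to orders in the automorphism group.

module _ {v : ℕ} (Γ : SimpleGraph v) where
  open Group (Aut Γ) using (rawMonoid)
  open RawMonoidDefs rawMonoid using () renaming (_×_ to _times_)
  open Automorphism

  G≗times : (srg : IsStronglyRegular Γ 14 1 2) (g : Automorphism Γ) → ∀ n w →
    Conway.Power.G Γ srg g n w ≡ perm (n times g) ⟨$⟩ʳ w
  G≗times srg g zero    w = refl
  G≗times srg g (suc n) w = cong (perm g ⟨$⟩ʳ_) (G≗times srg g n w)

  no-element-of-order-14 : v ≡ 99 → IsStronglyRegular Γ 14 1 2 → ¬ (∃[ g ] HasOrder (Aut Γ) g 14)
  no-element-of-order-14 v≡99 srg (g , _ , g¹⁴≈ε , minimal) = Conway.Power.Order14.no-automorphism Γ srg g
    (λ w → trans (G≗times srg g 14 w) (g¹⁴≈ε w))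
    (λ G2≗id → minimal 2 z<s (toWitness {a? = 2 <? 14} _) (λ w → trans (sym (G≗times srg g 2 w)) (G2≗id w)))
    (λ G7≗id → minimal 7 z<s (toWitness {a? = 7 <? 14} _) (λ w → trans (sym (G≗times srg g 7 w)) (G7≗id w)))
    v≡99

theorem3p11 : (Γ : SimpleGraph 99) → IsStronglyRegular Γ 14 1 2 →
    ¬ (∃[ g ] HasOrder (Aut Γ) g 14)
theorem3p11 Γ = no-element-of-order-14 Γ refl
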